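{- Let $G$, $H$ and $J$ be affine games. Then: (1) $G+(H+J)$ and $(G+H)+J$ are either equal or both undefined; (2) $G+H$ and $H+G$ are either equal or both undefined.
   Context: Affine games are defined recursively. There are two games without options, denoted $\infty$ and $\overline{\infty}$ (the affine games of day $-1$). Every other affine game is a form $G=\{G^{\mathcal L}\mid G^{\mathcal R}\}$, where $G^{\mathcal L}$ (the set of Left options) and $G^{\mathcal R}$ (the set of Right options) are non-empty finite sets of previously constructed affine games. Disjunctive sum (a partial operation): $G+H$ is not defined if one of $G,H$ is the form $\infty$ and the other is the form $\overline{\infty}$; $G+H=\infty$ if one of them is $\infty$ and the other is not $\overline\infty$; $G+H=\overline\infty$ if one of them is $\overline\infty$ and the other is not $\infty$; otherwise, recursively, $G+H=\{G^{\mathcal L}+H,\,G+H^{\mathcal L}\mid G^{\mathcal R}+H,\,G+H^{\mathcal R}\}$, where $G^{\mathcal L}+H,\,G+H^{\mathcal L}$ means $\{G^L+H: G^L\in G^{\mathcal L}\}\cup\{G+H^L: H^L\in H^{\mathcal L}\}$, and similarly for Right. A compound expression is undefined if one of its sub-sums is undefined. Here "equal" means equal as game forms (identical sets of options, recursively). -}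

module Defs where

open import Data.List.Base using (List; []; _∷_)
open import Data.List.NonEmpty using (List⁺; _∷_; toList; _⁺++⁺_)
import Data.List.NonEmpty.Effectful as List⁺Effectful
open import Data.List.Relation.Unary.All using (All)
open import Data.List.Relation.Unary.Any using (Any)
open import Data.Maybe.Base using (Maybe; just; nothing; _>>=_)
import Data.Maybe.Effectful as MaybeEffectful
open import Data.Product.Base using (_×_)
open import Level using (0ℓ)

open List⁺Effectful.TraversableA (MaybeEffectful.applicative {0ℓ}) using (sequenceA)

infix 4 _≈_ _≋_
infixl 6 _+_ _⊕_

-- A non-empty finite set of options is given by a non-empty enumeration.
-- Order and repetition are forgotten by _≈_, not by _≡_.
data Game : Set where
  ∞ ∞̄   : Game
  ⟨_∣_⟩ : (Gᴸ Gᴿ : List⁺ Game) → Game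

mutual
  data _≈_ : Game → Game → Set where
    ∞≈∞   : ∞ ≈ ∞
    ∞̄≈∞̄   : ∞̄ ≈ ∞̄
    ⟨_∣_⟩ : ∀ {Gᴸ Gᴿ Hᴸ Hᴿ} → Gᴸ ≋ Hᴸ → Gᴿ ≋ Hᴿ → ⟨ Gᴸ ∣ Gᴿ ⟩ ≈ ⟨ Hᴸ ∣ Hᴿ ⟩

  _≋_ : List⁺ Game → List⁺ Game → Set
  Gs ≋ Hs = All (λ G → Any (λ H → G ≈ H) (toList Hs)) (toList Gs)
          × All (λ H → Any (λ G → G ≈ H) (toList Gs)) (toList Hs)

-- The value nothing means that the sum is undefined.  A sum of two forms
-- with options would be undefined if one of the sums in its option sets were;
-- this never happens, because such a sum always has a summand with options.
mutual
  _+_ : Game → Game → Maybe Game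
  ∞ + ∞̄ = nothing
  ∞̄ + ∞ = nothing
  ∞ + ∞ = just ∞
  ∞ + ⟨ _ ∣ _ ⟩ = just ∞
  ⟨ _ ∣ _ ⟩ + ∞ = just ∞
  ∞̄ + ∞̄ = just ∞̄
  ∞̄ + ⟨ _ ∣ _ ⟩ = just ∞̄
  ⟨ _ ∣ _ ⟩ + ∞̄ = just ∞̄
  G@(⟨ Gᴸ ∣ Gᴿ ⟩) + H@(⟨ Hᴸ ∣ Hᴿ ⟩) =
    sequenceA ((Gᴸ +ˡ H) ⁺++⁺ (G +ʳ Hᴸ)) >>= λ Kᴸ →
    sequenceA ((Gᴿ +ˡ H) ⁺++⁺ (G +ʳ Hᴿ)) >>= λ Kᴿ →
    just ⟨ Kᴸ ∣ Kᴿ ⟩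

  -- Gs +ˡ H is map (_+ H) Gs and G +ʳ Hs is map (G +_) Hs, unfolded so that
  -- the recursion is visibly structural.
  _+ˡ_ : List⁺ Game → Game → List⁺ (Maybe Game)
  (G ∷ Gs) +ˡ H = (G + H) ∷ mapˡ Gs H

  mapˡ : List Game → Game → List (Maybe Game)
  mapˡ []       H = []
  mapˡ (G ∷ Gs) H = (G + H) ∷ mapˡ Gs H

  _+ʳ_ : Game → List⁺ Game → List⁺ (Maybe Game)
  G +ʳ (H ∷ Hs) = (G + H) ∷ mapʳ G Hs

  mapʳ : Game → List Game → List (Maybe Game)
  mapʳ G []       = []
  mapʳ G (H ∷ Hs) = (G + H) ∷ mapʳ G Hs

-- The sum of two expressions either of which may be undefined.
_⊕_ : Maybe Game → Maybe Game → Maybe Game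
x ⊕ y = x >>= λ G → y >>= λ H → G + H

{-# OPTIONS --safe #-}

-- A sum with a summand that has options is always defined, so undefinedness
-- only arises from ∞ + ∞̄.  When all of G, H, J have options, both G + (H + J)
-- and (G + H) + J enumerate the sums with one of the summands replaced by an
-- option, taken first from G, then from H, then from J: by induction they agree
-- even as enumerations.  Commutativity only exchanges the two blocks of options.
module Submission where

open import Defs
open import Data.List.Base using (List; []; _∷_)
import Data.List.Base as List
open import Data.List.NonEmpty using (List⁺; _∷_; toList; _⁺++⁺_; map)
import Data.List.Effectful as ListEffectful
import Data.List.NonEmpty.Effectful as List⁺Effectful
open import Data.List.NonEmpty.Properties using (map-∘; map-⁺++⁺; ⁺++⁺-assoc)
open import Data.List.Membership.Propositional using (lose)
open import Data.List.Properties using (map-cong-local; map-injective)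
open import Data.List.Relation.Unary.All as All using (All; []; _∷_)
import Data.List.Relation.Unary.All.Properties as All
open import Data.List.Relation.Unary.Any as Any using (Any)
import Data.List.Relation.Unary.Any.Properties as Any
open import Data.Maybe.Base using (Maybe; just; _>>=_)
import Data.Maybe.Effectful as MaybeEffectful
open import Data.Maybe.Properties using (just-injective)
open import Data.Maybe.Relation.Binary.Pointwise as Pointwise using (Pointwise; just; nothing)
open import Data.Product.Base using (∃; _×_; _,_; -,_; proj₂)
open import Data.Sum.Base using (_⊎_; inj₁; inj₂)
open import Data.Unit.Base using (⊤; tt)
open import Function.Base using (_∘_)
open import Level using (0ℓ)
open import Relation.Binary.PropositionalEquality
  using (_≡_; refl; sym; trans; cong; cong₂; subst₂; module ≡-Reasoning)

open List⁺Effectful.TraversableA (MaybeEffectful.applicative {0ℓ}) using (sequenceA)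
open ListEffectful.TraversableA (MaybeEffectful.applicative {0ℓ})
  using () renaming (sequenceA to sequenceList)

private
  variable
    A B : Set
    G H J K M : Game
    Gs Hs Js Ks Ms : List⁺ Game

-- Induction on games and reflexivity of equality

Options : (Game → Set) → Game → Set
Options P ∞           = ⊤
Options P ∞̄           = ⊤
Options P ⟨ Gᴸ ∣ Gᴿ ⟩ = All P (toList Gᴸ) × All P (toList Gᴿ)

module _ (P : Game → Set) (step : ∀ G → Options P G → P G) where
  mutual
    game-induction : ∀ G → P G
    game-induction ∞ = step ∞ tt
    game-induction ∞̄ = step ∞̄ tt
    game-induction K@(⟨ G ∷ Gs ∣ H ∷ Hs ⟩) =
      step K ( game-induction G ∷ game-induction-list Gs
             , game-induction H ∷ game-induction-list Hs)

    -- Walking through the options by hand keeps the recursion on games structural.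
    game-induction-list : ∀ Gs → All P Gs
    game-induction-list []       = []
    game-induction-list (G ∷ Gs) = game-induction G ∷ game-induction-list Gs

-- Every entry is its own witness. The two arguments of `R` may play different roles, as in
-- `Pointwise _≈_ (x + H) (H + y)`, so hypotheses about single options yield both halves of `_≋_`.
all-any-diagonal : {R : A → A → Set} {xs : List A} →
  All (λ x → R x x) xs → All (λ x → Any (R x) xs) xs
all-any-diagonal p = All.tabulate λ x∈xs → lose x∈xs (All.lookup p x∈xs)

≈-refl : ∀ G → G ≈ G
≈-refl = game-induction (λ G → G ≈ G) λ where
  ∞ _ → ∞≈∞
  ∞̄ _ → ∞̄≈∞̄
  ⟨ _ ∣ _ ⟩ (p , q) →
    ⟨ all-any-diagonal p , all-any-diagonal p ∣ all-any-diagonal q , all-any-diagonal q ⟩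

-- Non-empty lists and sequencing

toList-injective : {xs ys : List⁺ A} → toList xs ≡ toList ys → xs ≡ ys
toList-injective refl = refl

map⁺-cong-local : {f g : A → B} (xs : List⁺ A) →
  All (λ x → f x ≡ g x) (toList xs) → map f xs ≡ map g xs
map⁺-cong-local _ p = toList-injective (map-cong-local p)

map⁺-just-injective : {xs ys : List⁺ A} → map just xs ≡ map just ys → xs ≡ ys
map⁺-just-injective eq =
  toList-injective (map-injective just-injective (cong toList eq))

sequenceList-map-just : (xs : List Game) → sequenceList (List.map just xs) ≡ just xs
sequenceList-map-just []       = refl
sequenceList-map-just (x ∷ xs) rewrite sequenceList-map-just xs = refl

sequenceA-map-just : (xs : List⁺ Game) → sequenceA (map just xs) ≡ just xs
sequenceA-map-just (x ∷ xs) rewrite sequenceList-map-just xs = refl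

-- Option lists of a sum

-- Serves Left and Right options alike. The entries stay in `Maybe`, so sums can be compared entry
-- by entry before sequencing.
sumOptions : (G H : Game) (Gs Hs : List⁺ Game) → List⁺ (Maybe Game)
sumOptions G H Gs Hs = map (_+ H) Gs ⁺++⁺ map (G +_) Hs

mapˡ≡map : ∀ Gs H → mapˡ Gs H ≡ List.map (_+ H) Gs
mapˡ≡map []       H = refl
mapˡ≡map (G ∷ Gs) H = cong (G + H ∷_) (mapˡ≡map Gs H)

mapʳ≡map : ∀ G Hs → mapʳ G Hs ≡ List.map (G +_) Hs
mapʳ≡map G []       = refl
mapʳ≡map G (H ∷ Hs) = cong (G + H ∷_) (mapʳ≡map G Hs)

unfold-options : ∀ G H Gs Hs → (Gs +ˡ H) ⁺++⁺ (G +ʳ Hs) ≡ sumOptions G H Gs Hs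
unfold-options G H (G₀ ∷ Gs) (H₀ ∷ Hs) =
  cong₂ (λ xs ys → (G₀ + H ∷ xs) ⁺++⁺ (G + H₀ ∷ ys)) (mapˡ≡map Gs H) (mapʳ≡map G Hs)

sequence-options : ∀ G H Gs Hs → sumOptions G H Gs Hs ≡ map just Ks →
  sequenceA ((Gs +ˡ H) ⁺++⁺ (G +ʳ Hs)) ≡ just Ks
sequence-options G H Gs Hs eq =
  trans (cong sequenceA (trans (unfold-options G H Gs Hs) eq)) (sequenceA-map-just _)

-- Definedness of sums

Defined : Maybe Game → Set
Defined x = ∃ λ K → x ≡ just K

all-defined : {xs : List (Maybe Game)} → All Defined xs → ∃ λ ys → xs ≡ List.map just ys
all-defined []                = [] , refl
all-defined ((y , refl) ∷ ps) with ys , eq ← all-defined ps = y ∷ ys , cong (just y ∷_) eq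

all-defined⁺ : (xs : List⁺ (Maybe Game)) → All Defined (toList xs) → ∃ λ ys → xs ≡ map just ys
all-defined⁺ _ ((y , refl) ∷ ps) with ys , eq ← all-defined ps = y ∷ ys , cong (just y ∷_) eq

-- Once all entries are exhibited as `just` values, `sequenceA` in the definition of `_+_` succeeds,
-- and `sum≡` gives the sum explicitly.
record SumOfForms (Gᴸ Gᴿ Hᴸ Hᴿ : List⁺ Game) : Set where
  constructor sumOfForms
  field
    {Kᴸ Kᴿ} : List⁺ Game
    optionsᴸ : sumOptions ⟨ Gᴸ ∣ Gᴿ ⟩ ⟨ Hᴸ ∣ Hᴿ ⟩ Gᴸ Hᴸ ≡ map just Kᴸ
    optionsᴿ : sumOptions ⟨ Gᴸ ∣ Gᴿ ⟩ ⟨ Hᴸ ∣ Hᴿ ⟩ Gᴿ Hᴿ ≡ map just Kᴿ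

  sum≡ : ⟨ Gᴸ ∣ Gᴿ ⟩ + ⟨ Hᴸ ∣ Hᴿ ⟩ ≡ just ⟨ Kᴸ ∣ Kᴿ ⟩
  sum≡ = cong₂ (λ xᴸ xᴿ → xᴸ >>= λ Xᴸ → xᴿ >>= λ Xᴿ → just ⟨ Xᴸ ∣ Xᴿ ⟩)
    (sequence-options _ _ Gᴸ Hᴸ optionsᴸ) (sequence-options _ _ Gᴿ Hᴿ optionsᴿ)

data HasOptions : Game → Set where
  hasOptions : ∀ {Gᴸ Gᴿ} → HasOptions ⟨ Gᴸ ∣ Gᴿ ⟩

-- Requiring options of both summands would break the induction, since an option may be `∞` or `∞̄`.
SumDefined : Game → Game → Set
SumDefined G H = HasOptions G ⊎ HasOptions H → Defined (G + H)

-- Passing to an option changes only one summand; the other still has options and makes the entry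
-- defined.
options-defined : HasOptions G → HasOptions H →
  All (λ G′ → SumDefined G′ H) (toList Gs) → All (SumDefined G) (toList Hs) →
  ∃ λ Ks → sumOptions G H Gs Hs ≡ map just Ks
options-defined g h p q = all-defined⁺ _
  (All.++⁺ (All.map⁺ (All.map (λ d → d (inj₂ h)) p)) (All.map⁺ (All.map (λ d → d (inj₁ g)) q)))

sum-defined : ∀ G H → SumDefined G H
-- The outer hypothesis covers options of `G` against every second summand, the inner one options of
-- `H` with `G` fixed.
sum-defined = game-induction _ λ G ihG → game-induction _ (step G ihG)
  where
  step : ∀ G → Options (λ G′ → ∀ H → SumDefined G′ H) G →
         ∀ H → Options (SumDefined G) H → SumDefined G H
  step ∞ _ ∞ _ (inj₁ ())
  step ∞ _ ∞ _ (inj₂ ())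
  step ∞ _ ∞̄ _ (inj₁ ())
  step ∞ _ ∞̄ _ (inj₂ ())
  step ∞̄ _ ∞ _ (inj₁ ())
  step ∞̄ _ ∞ _ (inj₂ ())
  step ∞̄ _ ∞̄ _ (inj₁ ())
  step ∞̄ _ ∞̄ _ (inj₂ ())
  step ∞ _ ⟨ _ ∣ _ ⟩ _ _ = ∞ , refl
  step ∞̄ _ ⟨ _ ∣ _ ⟩ _ _ = ∞̄ , refl
  step ⟨ _ ∣ _ ⟩ _ ∞ _ _ = ∞ , refl
  step ⟨ _ ∣ _ ⟩ _ ∞̄ _ _ = ∞̄ , refl
  step ⟨ Gᴸ ∣ Gᴿ ⟩ (gᴸ , gᴿ) H@(⟨ Hᴸ ∣ Hᴿ ⟩) (hᴸ , hᴿ) _ =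
    -, SumOfForms.sum≡ (sumOfForms {Gᴸ} {Gᴿ} {Hᴸ} {Hᴿ}
      (proj₂ (options-defined hasOptions hasOptions (All.map (λ d → d H) gᴸ) hᴸ))
      (proj₂ (options-defined hasOptions hasOptions (All.map (λ d → d H) gᴿ) hᴿ)))

sum-of-forms : ∀ Gᴸ Gᴿ Hᴸ Hᴿ → SumOfForms Gᴸ Gᴿ Hᴸ Hᴿ
sum-of-forms Gᴸ Gᴿ Hᴸ Hᴿ = sumOfForms (proj₂ (options Gᴸ Hᴸ)) (proj₂ (options Gᴿ Hᴿ))
  where
  options : ∀ Gs Hs → ∃ λ Ks → sumOptions ⟨ Gᴸ ∣ Gᴿ ⟩ ⟨ Hᴸ ∣ Hᴿ ⟩ Gs Hs ≡ map just Ks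
  options Gs Hs = options-defined hasOptions hasOptions
    (All.universal (λ G′ → sum-defined G′ ⟨ Hᴸ ∣ Hᴿ ⟩) (toList Gs))
    (All.universal (sum-defined ⟨ Gᴸ ∣ Gᴿ ⟩) (toList Hs))

-- Commutativity

-- `Pointwise` relates `nothing` only to `nothing`, which renders "equal or both undefined".
Commutes : Game → Game → Set
Commutes G H = Pointwise _≈_ (G + H) (H + G)

-- The coverings are proved for entries in `Maybe`, then moved along `eqK` and `eqM`, where the
-- `just` is dropped.
sumOptions-comm : ∀ G H Gs Hs →
  All (λ G′ → Commutes G′ H) (toList Gs) → All (Commutes G) (toList Hs) →
  sumOptions G H Gs Hs ≡ map just Ks → sumOptions H G Hs Gs ≡ map just Ms → Ks ≋ Ms
sumOptions-comm {Ks} {Ms} G H Gs Hs p q eqK eqM =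
    All.map (Any.map Pointwise.drop-just ∘ Any.map⁻) (All.map⁻ (subst₂ Covers eqK eqM covers))
  , All.map (Any.map Pointwise.drop-just ∘ Any.map⁻) (All.map⁻ (subst₂ CoversBack eqK eqM coversBack))
  where
  Covers CoversBack : List⁺ (Maybe Game) → List⁺ (Maybe Game) → Set
  Covers     xs ys = All (λ x → Any (λ y → Pointwise _≈_ x y) (toList ys)) (toList xs)
  CoversBack xs ys = All (λ y → Any (λ x → Pointwise _≈_ x y) (toList xs)) (toList ys)

  covers : Covers (sumOptions G H Gs Hs) (sumOptions H G Hs Gs)
  covers = All.++⁺
    -- The sums `G′ + H` come first here, but their mirror images `H + G′` come second in the other
    -- list, hence `++⁺ʳ`.
    (All.map⁺ (All.map (Any.++⁺ʳ (List.map (_+ G) (toList Hs)) ∘ Any.map⁺) (all-any-diagonal p)))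
    (All.map⁺ (All.map (Any.++⁺ˡ ∘ Any.map⁺) (all-any-diagonal q)))

  coversBack : CoversBack (sumOptions G H Gs Hs) (sumOptions H G Hs Gs)
  coversBack = All.++⁺
    (All.map⁺ (All.map (Any.++⁺ʳ (List.map (_+ H) (toList Gs)) ∘ Any.map⁺) (all-any-diagonal q)))
    (All.map⁺ (All.map (Any.++⁺ˡ ∘ Any.map⁺) (all-any-diagonal p)))

+-comm : ∀ G H → Commutes G H
+-comm = game-induction _ λ G ihG → game-induction _ (step G ihG)
  where
  step : ∀ G → Options (λ G′ → ∀ H → Commutes G′ H) G →
         ∀ H → Options (Commutes G) H → Commutes G H
  step ∞ _ ∞ _ = just ∞≈∞
  step ∞ _ ∞̄ _ = nothing
  step ∞̄ _ ∞ _ = nothing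
  step ∞̄ _ ∞̄ _ = just ∞̄≈∞̄
  step ∞ _ ⟨ _ ∣ _ ⟩ _ = just ∞≈∞
  step ∞̄ _ ⟨ _ ∣ _ ⟩ _ = just ∞̄≈∞̄
  step ⟨ _ ∣ _ ⟩ _ ∞ _ = just ∞≈∞
  step ⟨ _ ∣ _ ⟩ _ ∞̄ _ = just ∞̄≈∞̄
  step G@(⟨ Gᴸ ∣ Gᴿ ⟩) (gᴸ , gᴿ) H@(⟨ Hᴸ ∣ Hᴿ ⟩) (hᴸ , hᴿ) =
    subst₂ (Pointwise _≈_) (sym GH.sum≡) (sym HG.sum≡) (just
      ⟨ sumOptions-comm G H Gᴸ Hᴸ (All.map (λ c → c H) gᴸ) hᴸ GH.optionsᴸ HG.optionsᴸ
      ∣ sumOptions-comm G H Gᴿ Hᴿ (All.map (λ c → c H) gᴿ) hᴿ GH.optionsᴿ HG.optionsᴿ ⟩)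
    where
    module GH = SumOfForms (sum-of-forms Gᴸ Gᴿ Hᴸ Hᴿ)
    module HG = SumOfForms (sum-of-forms Hᴸ Hᴿ Gᴸ Gᴿ)

-- Associativity

-- Using `_≡_` on enumerations lets the induction hypotheses be applied under `map`; both sides may
-- be `nothing`.
Associates : Game → Game → Game → Set
Associates G H J = just G ⊕ (H + J) ≡ (G + H) ⊕ just J

-- Both lists split into three blocks, with an option taken from `G`, `H` or `J`. The hypotheses
-- match the blocks entrywise and `⁺++⁺-assoc` moves the brackets.
sumOptions-assoc : H + J ≡ just K → G + H ≡ just M →
  sumOptions H J Hs Js ≡ map just Ks → sumOptions G H Gs Hs ≡ map just Ms →
  All (λ G′ → Associates G′ H J) (toList Gs) →
  All (λ H′ → Associates G H′ J) (toList Hs) →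
  All (Associates G H) (toList Js) →
  sumOptions G K Gs Ks ≡ sumOptions M J Ms Js
sumOptions-assoc {H} {J} {K} {G} {M} {Hs} {Js} {Ks} {Gs} {Ms} HJ≡K GH≡M Ks≡ Ms≡ p q r = begin
  map (_+ K) Gs ⁺++⁺ map (G +_) Ks
    ≡⟨ cong₂ _⁺++⁺_ (cong (λ x → map (λ G′ → just G′ ⊕ x) Gs) (sym HJ≡K)) optionsK ⟩
  map (λ G′ → just G′ ⊕ (H + J)) Gs
    ⁺++⁺ (map (λ H′ → just G ⊕ (H′ + J)) Hs ⁺++⁺ map (λ J′ → just G ⊕ (H + J′)) Js)
    ≡⟨ cong₂ _⁺++⁺_ (map⁺-cong-local Gs p)
         (cong₂ _⁺++⁺_ (map⁺-cong-local Hs q) (map⁺-cong-local Js r)) ⟩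
  map (λ G′ → (G′ + H) ⊕ just J) Gs
    ⁺++⁺ (map (λ H′ → (G + H′) ⊕ just J) Hs ⁺++⁺ map (λ J′ → (G + H) ⊕ just J′) Js)
    ≡⟨ ⁺++⁺-assoc (map (λ G′ → (G′ + H) ⊕ just J) Gs) _ _ ⟨
  (map (λ G′ → (G′ + H) ⊕ just J) Gs ⁺++⁺ map (λ H′ → (G + H′) ⊕ just J) Hs)
    ⁺++⁺ map (λ J′ → (G + H) ⊕ just J′) Js
    ≡⟨ cong₂ _⁺++⁺_ optionsM (cong (λ x → map (λ J′ → x ⊕ just J′) Js) (sym GH≡M)) ⟨
  map (_+ J) Ms ⁺++⁺ map (M +_) Js ∎
  where
  open ≡-Reasoning

  optionsK : map (G +_) Ks ≡
    map (λ H′ → just G ⊕ (H′ + J)) Hs ⁺++⁺ map (λ J′ → just G ⊕ (H + J′)) Js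
  optionsK = begin
    -- Adding `G` to a game computes as `just G ⊕_` on its `just`, so the map can act on the
    -- unsequenced options of `H + J`.
    map (G +_) Ks                              ≡⟨ map-∘ Ks ⟩
    map (just G ⊕_) (map just Ks)              ≡⟨ cong (map (just G ⊕_)) Ks≡ ⟨
    map (just G ⊕_) (sumOptions H J Hs Js)     ≡⟨ map-⁺++⁺ (just G ⊕_) (map (_+ J) Hs) _ ⟩
    map (just G ⊕_) (map (_+ J) Hs) ⁺++⁺ map (just G ⊕_) (map (H +_) Js)
      ≡⟨ cong₂ _⁺++⁺_ (map-∘ Hs) (map-∘ Js) ⟨
    map (λ H′ → just G ⊕ (H′ + J)) Hs ⁺++⁺ map (λ J′ → just G ⊕ (H + J′)) Js ∎

  optionsM : map (_+ J) Ms ≡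
    map (λ G′ → (G′ + H) ⊕ just J) Gs ⁺++⁺ map (λ H′ → (G + H′) ⊕ just J) Hs
  optionsM = begin
    map (_+ J) Ms                              ≡⟨ map-∘ Ms ⟩
    map (_⊕ just J) (map just Ms)              ≡⟨ cong (map (_⊕ just J)) Ms≡ ⟨
    map (_⊕ just J) (sumOptions G H Gs Hs)     ≡⟨ map-⁺++⁺ (_⊕ just J) (map (_+ H) Gs) _ ⟩
    map (_⊕ just J) (map (_+ H) Gs) ⁺++⁺ map (_⊕ just J) (map (G +_) Hs)
      ≡⟨ cong₂ _⁺++⁺_ (map-∘ Gs) (map-∘ Hs) ⟨
    map (λ G′ → (G′ + H) ⊕ just J) Gs ⁺++⁺ map (λ H′ → (G + H′) ⊕ just J) Hs ∎

+-assoc : ∀ G H J → Associates G H J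
+-assoc = game-induction _ λ G ihG → game-induction _ λ H ihH → game-induction _ (step G ihG H ihH)
  where
  step : ∀ G → Options (λ G′ → ∀ H J → Associates G′ H J) G →
         ∀ H → Options (λ H′ → ∀ J → Associates G H′ J) H →
         ∀ J → Options (Associates G H) J → Associates G H J
  -- As long as neither inner sum adds two games with options, both sides compute.
  step ∞ _ ∞ _ ∞ _ = refl
  step ∞ _ ∞ _ ∞̄ _ = refl
  step ∞ _ ∞ _ ⟨ _ ∣ _ ⟩ _ = refl
  step ∞ _ ∞̄ _ ∞ _ = refl
  step ∞ _ ∞̄ _ ∞̄ _ = refl
  step ∞ _ ∞̄ _ ⟨ _ ∣ _ ⟩ _ = refl
  step ∞ _ ⟨ _ ∣ _ ⟩ _ ∞ _ = refl
  step ∞ _ ⟨ _ ∣ _ ⟩ _ ∞̄ _ = refl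
  step ∞̄ _ ∞ _ ∞ _ = refl
  step ∞̄ _ ∞ _ ∞̄ _ = refl
  step ∞̄ _ ∞ _ ⟨ _ ∣ _ ⟩ _ = refl
  step ∞̄ _ ∞̄ _ ∞ _ = refl
  step ∞̄ _ ∞̄ _ ∞̄ _ = refl
  step ∞̄ _ ∞̄ _ ⟨ _ ∣ _ ⟩ _ = refl
  step ∞̄ _ ⟨ _ ∣ _ ⟩ _ ∞ _ = refl
  step ∞̄ _ ⟨ _ ∣ _ ⟩ _ ∞̄ _ = refl
  step ⟨ _ ∣ _ ⟩ _ ∞ _ ∞ _ = refl
  step ⟨ _ ∣ _ ⟩ _ ∞ _ ∞̄ _ = refl
  step ⟨ _ ∣ _ ⟩ _ ∞ _ ⟨ _ ∣ _ ⟩ _ = refl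
  step ⟨ _ ∣ _ ⟩ _ ∞̄ _ ∞ _ = refl
  step ⟨ _ ∣ _ ⟩ _ ∞̄ _ ∞̄ _ = refl
  step ⟨ _ ∣ _ ⟩ _ ∞̄ _ ⟨ _ ∣ _ ⟩ _ = refl
  -- The infinite summand absorbs the inner sum only once that sum is known to be a form with
  -- options.
  step ∞ _ ⟨ Hᴸ ∣ Hᴿ ⟩ _ ⟨ Jᴸ ∣ Jᴿ ⟩ _ =
    cong (just ∞ ⊕_) (SumOfForms.sum≡ (sum-of-forms Hᴸ Hᴿ Jᴸ Jᴿ))
  step ∞̄ _ ⟨ Hᴸ ∣ Hᴿ ⟩ _ ⟨ Jᴸ ∣ Jᴿ ⟩ _ =
    cong (just ∞̄ ⊕_) (SumOfForms.sum≡ (sum-of-forms Hᴸ Hᴿ Jᴸ Jᴿ))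
  step ⟨ Gᴸ ∣ Gᴿ ⟩ _ ⟨ Hᴸ ∣ Hᴿ ⟩ _ ∞ _ =
    sym (cong (_⊕ just ∞) (SumOfForms.sum≡ (sum-of-forms Gᴸ Gᴿ Hᴸ Hᴿ)))
  step ⟨ Gᴸ ∣ Gᴿ ⟩ _ ⟨ Hᴸ ∣ Hᴿ ⟩ _ ∞̄ _ =
    sym (cong (_⊕ just ∞̄) (SumOfForms.sum≡ (sum-of-forms Gᴸ Gᴿ Hᴸ Hᴿ)))
  step G@(⟨ Gᴸ ∣ Gᴿ ⟩) (gᴸ , gᴿ) H@(⟨ Hᴸ ∣ Hᴿ ⟩) (hᴸ , hᴿ) J@(⟨ Jᴸ ∣ Jᴿ ⟩) (jᴸ , jᴿ) = begin
    just G ⊕ (H + J)                ≡⟨ cong (just G ⊕_) HJ.sum≡ ⟩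
    G + ⟨ HJ.Kᴸ ∣ HJ.Kᴿ ⟩           ≡⟨ G+K.sum≡ ⟩
    just ⟨ G+K.Kᴸ ∣ G+K.Kᴿ ⟩        ≡⟨ cong₂ (λ Xᴸ Xᴿ → just ⟨ Xᴸ ∣ Xᴿ ⟩) optionsᴸ optionsᴿ ⟩
    just ⟨ M+J.Kᴸ ∣ M+J.Kᴿ ⟩        ≡⟨ M+J.sum≡ ⟨
    ⟨ GH.Kᴸ ∣ GH.Kᴿ ⟩ + J           ≡⟨ cong (_⊕ just J) GH.sum≡ ⟨
    (G + H) ⊕ just J                ∎
    where
    open ≡-Reasoning
    module HJ = SumOfForms (sum-of-forms Hᴸ Hᴿ Jᴸ Jᴿ)
    module GH = SumOfForms (sum-of-forms Gᴸ Gᴿ Hᴸ Hᴿ)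
    module G+K = SumOfForms (sum-of-forms Gᴸ Gᴿ HJ.Kᴸ HJ.Kᴿ)
    module M+J = SumOfForms (sum-of-forms GH.Kᴸ GH.Kᴿ Jᴸ Jᴿ)

    optionsᴸ : G+K.Kᴸ ≡ M+J.Kᴸ
    -- The enumerations are compared inside `Maybe`, and injectivity of `map just` brings the
    -- equality back to games.
    optionsᴸ = map⁺-just-injective (trans (sym G+K.optionsᴸ) (trans
      (sumOptions-assoc HJ.sum≡ GH.sum≡ HJ.optionsᴸ GH.optionsᴸ
        (All.map (λ a → a H J) gᴸ) (All.map (λ a → a J) hᴸ) jᴸ)
      M+J.optionsᴸ))

    optionsᴿ : G+K.Kᴿ ≡ M+J.Kᴿ
    optionsᴿ = map⁺-just-injective (trans (sym G+K.optionsᴿ) (trans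
      (sumOptions-assoc HJ.sum≡ GH.sum≡ HJ.optionsᴿ GH.optionsᴿ
        (All.map (λ a → a H J) gᴿ) (All.map (λ a → a J) hᴿ) jᴿ)
      M+J.optionsᴿ))

theorem5 : (G H J : Game) →
    Pointwise _≈_ (just G ⊕ (H + J)) ((G + H) ⊕ just J)
    × Pointwise _≈_ (G + H) (H + G)
theorem5 G H J =
  Pointwise.reflexive (λ { refl → ≈-refl _ }) (+-assoc G H J) , +-comm G H
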